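{- Let $0\le i\le N$ and $1\le j\le N$. Node $n_i$ is forward-connected to node $n_j$ if and only if $i<j$ and there exist an integer $p\ge 0$ and indices $k_1,\dots,k_p$ with $i<k_1<k_2<\dots<k_p<j$ such that $$C^{\mathbf{A}}_{k_1}+C^{\mathbf{A}}_{k_2}+\cdots+C^{\mathbf{A}}_{k_p}+C^{\mathbf{A}}_j=X_j^N-X_i^N .$$ (When $p=0$ the left-hand side is just $C^{\mathbf{A}}_j$.)
   Context: Let $G$ be a finite tree (connected acyclic simple graph) with nodes $n_0,n_1,\dots,n_N$, $N\ge 1$, where $n_0$ is a terminal node (degree one) and the nodes are indexed so that along the path in $G$ from $n_0$ to any node $n_i$ the successively encountered node indices strictly increase. Node $n_i$ is forward-adjacent to $n_k$ if $n_i$ and $n_k$ are adjacent and $i<k$. Node $n_i$ is forward-connected to $n_j$ ($i<j$ necessarily) if there is a sequence of nodes $n_i=n_{l_0},n_{l_1},\dots,n_{l_m}=n_j$ with $m\ge 1$ in which each $n_{l_t}$ is forward-adjacent to $n_{l_{t+1}}$. The forward adjacency matrix $\mathbf{A}$ of $G$ is the $N\times N$ matrix, with rows and columns indexed by $1,\dots,N$, given by $\mathbf{A}(i,j)=1$ if $i=j$, $\mathbf{A}(i,j)=-1$ if $n_i$ is forward-adjacent to $n_j$, and $\mathbf{A}(i,j)=0$ otherwise. $C^{\mathbf{Q}}_j$ denotes the $j$-th column of a matrix $\mathbf{Q}$. For $1\le i\le N$, $X_i^N$ is the $N$-dimensional column vector with $1$ as its $i$-th entry and zeros elsewhere; $X_0^N$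 is the $N$-dimensional zero vector. -}

module Defs where

open import Level using (0ℓ)
open import Data.Bool using (if_then_else_)
open import Data.Fin using (Fin; zero; suc; _<_; _<?_; _≟_)
open import Data.Integer as ℤ using (ℤ; 0ℤ; 1ℤ; -1ℤ)
open import Data.List using (List; []; _∷_; foldr; filter; length; allFin)
import Data.List as List
open import Data.List.Relation.Unary.Linked using (Linked)
open import Data.List.Relation.Unary.Unique.Propositional using (Unique)
open import Data.Nat using (ℕ; suc; _≤_)
open import Data.Product using (_×_)
open import Data.Vec.Functional using (Vector; zipWith)
open import Relation.Binary using (Rel; Symmetric; Irreflexive; Decidable)
open import Relation.Binary.Construct.Closure.ReflexiveTransitive using (Star; ε; _◅_)
open import Relation.Binary.Construct.Closure.Transitive using (TransClosure)
open import Relation.Binary.PropositionalEquality using (_≡_)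
open import Relation.Nullary using (¬_; does)
open import Relation.Nullary.Decidable using (_×-dec_)

-- Decidability of adjacency is automatic classically; it is needed to
-- compute degrees and matrix entries.
record SimpleGraph (n : ℕ) : Set₁ where
  infix 4 _~_ _~?_
  field
    _~_    : Rel (Fin n) 0ℓ
    _~?_   : Decidable _~_
    ~-sym  : Symmetric _~_
    ~-irr  : Irreflexive _≡_ _~_

module _ {n : ℕ} (G : SimpleGraph n) where
  open SimpleGraph G

  Walk : Rel (Fin n) 0ℓ
  Walk = Star _~_

  -- Both endpoints are included.
  vertices : ∀ {u v} → Walk u v → List (Fin n)
  vertices {u} ε       = u ∷ []
  vertices {u} (_ ◅ w) = u ∷ vertices w

  IsPath : ∀ {u v} → Walk u v → Set
  IsPath w = Unique (vertices w)

  Connected : Set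
  Connected = ∀ u v → Walk u v

  -- A cycle is a path on at least three vertices whose endpoints are adjacent.
  Acyclic : Set
  Acyclic = ∀ {u v} (w : Walk u v) → IsPath w → 3 ≤ length (vertices w) → ¬ (v ~ u)

  IsTree : Set
  IsTree = Connected × Acyclic

  degree : Fin n → ℕ
  degree u = length (filter (u ~?_) (allFin n))

  Terminal : Fin n → Set
  Terminal u = degree u ≡ 1

  ForwardAdjacent : Rel (Fin n) 0ℓ
  ForwardAdjacent u v = u ~ v × u < v

  forwardAdjacent? : Decidable ForwardAdjacent
  forwardAdjacent? u v = (u ~? v) ×-dec (u <? v)

  ForwardConnected : Rel (Fin n) 0ℓ
  ForwardConnected = TransClosure ForwardAdjacent

-- In a tree there is exactly one path from n₀ to each node, so quantifying over
-- all such paths is the same as speaking of "the" path.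
IncreasinglyIndexed : ∀ {N} → SimpleGraph (suc N) → Set
IncreasinglyIndexed G =
  ∀ {v} (w : Walk G zero v) → IsPath G w → Linked _<_ (vertices G w)

Matrix : ℕ → Set
Matrix N = Fin N → Fin N → ℤ

column : ∀ {N} → Matrix N → Fin N → Vector ℤ N
column Q c r = Q r c

infixl 6 _⊕_ _⊖_

_⊕_ _⊖_ : ∀ {N} → Vector ℤ N → Vector ℤ N → Vector ℤ N
_⊕_ = zipWith ℤ._+_
_⊖_ = zipWith ℤ._-_

-- Rows and columns are indexed by the nodes n₁ , … , n_N: the matrix index
-- r : Fin N stands for the node suc r.
forwardAdjacencyMatrix : ∀ {N} → SimpleGraph (suc N) → Matrix N
forwardAdjacencyMatrix G r c =
  if does (r ≟ c) then 1ℤ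
  else if does (forwardAdjacent? G (suc r) (suc c)) then -1ℤ
  else 0ℤ

-- X i is the vector X_i^N: zero for i = 0, otherwise a standard basis vector.
X : ∀ {N} → Fin (suc N) → Vector ℤ N
X zero    r = 0ℤ
X (suc i) r = if does (r ≟ i) then 1ℤ else 0ℤ

-- columnSum Q (k₁ ∷ … ∷ k_p ∷ []) j = C_{k₁} ⊕ (… ⊕ (C_{k_p} ⊕ C_j)).
columnSum : ∀ {N} → Matrix N → List (Fin N) → Fin N → Vector ℤ N
columnSum Q ks j = foldr _⊕_ (column Q j) (List.map (column Q) ks)

{-# OPTIONS --safe #-}

-- Every node n_c with c ≥ 1 has exactly one forward-adjacent predecessor n_u:
-- two of them would be joined, through n₀, by a walk inside {n_0, …, n_{c-1}},
-- and n_c would close it to a cycle.  Hence C_c = X_c − X_u, and the columns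
-- along a forward walk telescope.  Conversely, row r of the column equation
-- shows that each node n_r among n_i, n_{k_1}, …, n_{k_p} (r ≥ 1) is
-- forward-adjacent to some n_k with k ∈ {k_1, …, k_p, j}, since otherwise the
-- row sum would be too large; following these edges upwards must end in n_j.
-- For i = 0 the equation is not needed, as n₀ is forward-connected to every
-- other node.
module Submission where

open import Defs
open import Data.Fin using (Fin; zero; suc; _<_; _>_; _≟_)
open import Data.Fin.Induction using (>-wellFounded)
import Data.Fin as Fin
import Data.Fin.Properties as Fin
open import Data.Integer as ℤ using (0ℤ; 1ℤ; -1ℤ)
import Data.Integer.Properties as ℤ
open import Data.Integer.Tactic.RingSolver using (solve-∀)
open import Data.List using (List; []; _∷_; _∷ʳ_; length; map)
import Data.List.Membership.DecPropositional as DecMembership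
open import Data.List.Membership.Propositional using (_∈_; find)
open import Data.List.Membership.Propositional.Properties using (∈-++⁻)
open import Data.List.Relation.Binary.Subset.Propositional using (_⊆_)
open import Data.List.Relation.Unary.All as All using (All; []; _∷_)
import Data.List.Relation.Unary.All.Properties as All
open import Data.List.Relation.Unary.AllPairs using ([]; _∷_)
open import Data.List.Relation.Unary.Any using (Any; here; there; any?)
open import Data.List.Relation.Unary.Linked using (Linked; [-]; _∷_)
import Data.Nat as ℕ
open import Data.Nat using (ℕ; _≤_; z≤n; s≤s)
import Data.Nat.Properties as ℕ
open import Data.Product using (_×_; ∃-syntax; _,_)
open import Data.Sum using (_⊎_; inj₁; inj₂)
open import Function using (_∘_; case_of_)
open import Function.Bundles using (_⇔_; mk⇔)
open import Induction.WellFounded using (Acc; acc)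
open import Relation.Binary using (Rel)
open import Relation.Binary.Construct.Closure.ReflexiveTransitive
  using (Star; ε; _◅_; _◅◅_; reverse)
open import Relation.Binary.Construct.Closure.Transitive using ([_]; _∷_)
open import Relation.Binary.PropositionalEquality
  using (_≡_; _≢_; _≗_; refl; sym; trans; cong; cong₂; subst; ≢-sym)
open import Relation.Nullary using (¬_; yes; no; contradiction)
open import Relation.Nullary.Decidable using (dec-true; dec-false)

linked-last : ∀ {n} (xs : List (Fin n)) {z} → Linked _<_ (xs ∷ʳ z) → All (_< z) xs
linked-last []           _         = []
linked-last (x ∷ [])     (x<z ∷ _) = x<z ∷ []
linked-last (x ∷ y ∷ ys) (x<y ∷ l) with linked-last (y ∷ ys) l
... | y<z ∷ ys<z = ℕ.<-trans x<y y<z ∷ y<z ∷ ys<z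

module _ {n : ℕ} (G : SimpleGraph n) where
  open SimpleGraph G
  open DecMembership (_≟_ {n}) using (_∈?_)

  path-suffix : ∀ {x u v} (p : Walk G x v) → IsPath G p → u ∈ vertices G p →
    ∃[ q ] (IsPath G {u} {v} q × vertices G q ⊆ vertices G p)
  path-suffix ε       isPath       (here refl) = ε , isPath , λ z → z
  path-suffix (e ◅ p) isPath       (here refl) = e ◅ p , isPath , λ z → z
  path-suffix (e ◅ p) (_ ∷ isPath) (there u∈p) with path-suffix p isPath u∈p
  ... | q , isPath′ , q⊆p = q , isPath′ , there ∘ q⊆p

  walk⇒path : ∀ {u v} (w : Walk G u v) →
    ∃[ p ] (IsPath G {u} {v} p × vertices G p ⊆ vertices G w)
  walk⇒path ε = ε , [] ∷ [] , λ z → z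
  walk⇒path {u} (e ◅ w) with walk⇒path w
  ... | p , isPath , p⊆w with u ∈? vertices G p
  ...   | no  u∉p = e ◅ p , All.¬Any⇒All¬ _ u∉p ∷ isPath ,
                    λ { (here refl) → here refl ; (there z) → there (p⊆w z) }
  ...   | yes u∈p with path-suffix p isPath u∈p
  ...     | q , isPath′ , q⊆p = q , isPath′ , there ∘ p⊆w ∘ q⊆p

  linked⇒forward : ∀ {u v} (w : Walk G u v) → Linked _<_ (vertices G w) →
    Star (ForwardAdjacent G) u v
  linked⇒forward ε            _         = ε
  linked⇒forward (e ◅ ε)      (u<v ∷ _) = (e , u<v) ◅ ε
  linked⇒forward (e ◅ e′ ◅ w) (u<v ∷ l) = (e , u<v) ◅ linked⇒forward (e′ ◅ w) l

  ◅⇒forwardConnected : ∀ {u x v} → ForwardAdjacent G u x →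
    Star (ForwardAdjacent G) x v → ForwardConnected G u v
  ◅⇒forwardConnected e ε        = [ e ]
  ◅⇒forwardConnected e (e′ ◅ s) = e ∷ ◅⇒forwardConnected e′ s

  AdjacentBelow : Fin n → Rel (Fin n) _
  AdjacentBelow c u v = u ~ v × u < c × v < c

  adjacentBelow-sym : ∀ {c u v} → AdjacentBelow c u v → AdjacentBelow c v u
  adjacentBelow-sym (e , u<c , v<c) = ~-sym e , v<c , u<c

  forward⇒≤ : ∀ {u v} → Star (ForwardAdjacent G) u v → u Fin.≤ v
  forward⇒≤ ε               = ℕ.≤-refl
  forward⇒≤ ((_ , u<x) ◅ s) = ℕ.≤-trans (ℕ.<⇒≤ u<x) (forward⇒≤ s)

  forward⇒below : ∀ {c u v} → v < c → Star (ForwardAdjacent G) u v →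
    Star (AdjacentBelow c) u v
  forward⇒below v<c ε = ε
  forward⇒below v<c ((e , u<x) ◅ s) =
    (e , ℕ.<-trans u<x x<c , x<c) ◅ forward⇒below v<c s
    where x<c = ℕ.≤-<-trans (forward⇒≤ s) v<c

  below⇒walk : ∀ {c u v} → u < c → Star (AdjacentBelow c) u v →
    ∃[ w ] All (_< c) (vertices G {u} {v} w)
  below⇒walk u<c ε = ε , u<c ∷ []
  below⇒walk u<c ((e , _ , x<c) ◅ s) with below⇒walk x<c s
  ... | w , w<c = e ◅ w , u<c ∷ w<c

  acyclic⇒same-neighbour : Acyclic G → ∀ {c u v} → u ~ c → v ~ c → u < c →
    Star (AdjacentBelow c) u v → u ≡ v
  acyclic⇒same-neighbour acyclic u~c v~c u<c s with below⇒walk u<c s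
  ... | w , w<c with walk⇒path w
  ...   | ε , _ , _ = refl
  ...   | e ◅ p , isPath , p⊆w =
    contradiction v~c
      (acyclic (~-sym u~c ◅ e ◅ p)
        (All.tabulate (λ z c≡z → Fin.<⇒≢ (All.lookup w<c (p⊆w z)) (sym c≡z)) ∷ isPath)
        (s≤s (s≤s (nonempty p))))
    where
    nonempty : ∀ {x y} (p : Walk G x y) → 1 ≤ length (vertices G p)
    nonempty ε       = s≤s z≤n
    nonempty (_ ◅ _) = s≤s z≤n

module _ {N : ℕ} (Q : Matrix N) {r j : Fin N} where

  columnSum-nonneg : ∀ ks → All (λ k → 0ℤ ℤ.≤ Q r k) (ks ∷ʳ j) → 0ℤ ℤ.≤ columnSum Q ks j r
  columnSum-nonneg []       (q ∷ []) = q
  columnSum-nonneg (k ∷ ks) (q ∷ qs) = ℤ.+-mono-≤ q (columnSum-nonneg ks qs)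

  columnSum-pos : ∀ {k} ks → k ∈ ks → 0ℤ ℤ.< Q r k →
    All (λ k → 0ℤ ℤ.≤ Q r k) (ks ∷ʳ j) → 0ℤ ℤ.< columnSum Q ks j r
  columnSum-pos (k ∷ ks) (here refl) 0<q (_ ∷ qs) = ℤ.+-mono-<-≤ 0<q (columnSum-nonneg ks qs)
  columnSum-pos (k ∷ ks) (there k∈)  0<q (q ∷ qs) = ℤ.+-mono-≤-< q (columnSum-pos ks k∈ 0<q qs)

X-≡ : ∀ {N} (r : Fin N) → X (suc r) r ≡ 1ℤ
X-≡ r rewrite dec-true (r ≟ r) refl = refl

X-≢ : ∀ {N} (i : Fin (ℕ.suc N)) {r : Fin N} → suc r ≢ i → X i r ≡ 0ℤ
X-≢ zero        _   = refl
X-≢ (suc i) {r} r≢i rewrite dec-false (r ≟ i) (r≢i ∘ cong suc) = refl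

X-nonneg : ∀ {N} (i : Fin (ℕ.suc N)) (r : Fin N) → 0ℤ ℤ.≤ X i r
X-nonneg i r with suc r ≟ i
... | yes refl = ℤ.≤-trans (ℤ.+≤+ z≤n) (ℤ.≤-reflexive (sym (X-≡ r)))
... | no  r≢i  = ℤ.≤-reflexive (sym (X-≢ i r≢i))

module _ {N : ℕ} (G : SimpleGraph (ℕ.suc N)) where
  open SimpleGraph G

  private
    A : Matrix N
    A = forwardAdjacencyMatrix G

  A-diagonal : ∀ r → A r r ≡ 1ℤ
  A-diagonal r rewrite dec-true (r ≟ r) refl = refl

  A-adjacent : ∀ {r c} → ForwardAdjacent G (suc r) (suc c) → A r c ≡ -1ℤ
  A-adjacent {r} {c} e@(_ , s≤s r<c)
    rewrite dec-false (r ≟ c) (Fin.<⇒≢ r<c)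
          | dec-true (forwardAdjacent? G (suc r) (suc c)) e = refl

  A-nonadjacent : ∀ {r c} → r ≢ c → ¬ ForwardAdjacent G (suc r) (suc c) → A r c ≡ 0ℤ
  A-nonadjacent {r} {c} r≢c ¬e
    rewrite dec-false (r ≟ c) r≢c
          | dec-false (forwardAdjacent? G (suc r) (suc c)) ¬e = refl

  A-nonneg : ∀ {r c} → ¬ ForwardAdjacent G (suc r) (suc c) → 0ℤ ℤ.≤ A r c
  A-nonneg {r} {c} ¬e rewrite dec-false (forwardAdjacent? G (suc r) (suc c)) ¬e with r ≟ c
  ... | yes _ = ℤ.+≤+ z≤n
  ... | no  _ = ℤ.≤-refl

  module _ (connected : Connected G) (increasing : IncreasinglyIndexed G) where

    forward-from-zero : ∀ v → Star (ForwardAdjacent G) zero v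
    forward-from-zero v with walk⇒path G (connected zero v)
    ... | p , isPath , _ = linked⇒forward G p (increasing p isPath)

    zero-forwardConnected : ∀ j → ForwardConnected G zero (suc j)
    zero-forwardConnected j with forward-from-zero (suc j)
    ... | e ◅ s = ◅⇒forwardConnected G e s

    module _ (acyclic : Acyclic G) where

      forward-predecessor-unique : ∀ {c u v} →
        ForwardAdjacent G u c → ForwardAdjacent G v c → u ≡ v
      forward-predecessor-unique {u = u} {v} (u~c , u<c) (v~c , v<c) =
        acyclic⇒same-neighbour G acyclic u~c v~c u<c
          (reverse (adjacentBelow-sym G) (forward⇒below G u<c (forward-from-zero u))
            ◅◅ forward⇒below G v<c (forward-from-zero v))

      column-difference : ∀ {i c} → ForwardAdjacent G i (suc c) →
        column A c ≗ (X (suc c) ⊖ X i)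
      column-difference {i} {c} e@(_ , i<c) r = case r ≟ c of λ where
        (yes refl) → trans (A-diagonal r)
          (sym (cong₂ ℤ._-_ (X-≡ r) (X-≢ i (≢-sym (Fin.<⇒≢ i<c)))))
        (no r≢c) → case suc r ≟ i of λ where
          (yes refl) → trans (A-adjacent e)
            (sym (cong₂ ℤ._-_ (X-≢ (suc c) (r≢c ∘ Fin.suc-injective)) (X-≡ r)))
          (no r≢i) → trans
            (A-nonadjacent r≢c (λ e′ → r≢i (forward-predecessor-unique e′ e)))
            (sym (cong₂ ℤ._-_ (X-≢ (suc c) (r≢c ∘ Fin.suc-injective)) (X-≢ i r≢i)))

      forwardConnected⇒columnSum : ∀ {i j} → ForwardConnected G i (suc j) →
        ∃[ ks ] (Linked _<_ (i ∷ (map suc ks ∷ʳ suc j)) ×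
                 columnSum A ks j ≗ (X (suc j) ⊖ X i))
      forwardConnected⇒columnSum [ e@(_ , i<j) ] = [] , i<j ∷ [-] , column-difference e
      forwardConnected⇒columnSum {i} {j} (_∷_ {y = suc k} e@(_ , i<k) es)
        with forwardConnected⇒columnSum es
      ... | ks , linked , sum≗ = k ∷ ks , i<k ∷ linked , λ r →
        trans (cong₂ ℤ._+_ (column-difference e r) (sum≗ r))
              (telescope (X (suc k) r) (X i r) (X (suc j) r))
        where
        telescope : ∀ x y z → (x ℤ.- y) ℤ.+ (z ℤ.- x) ≡ z ℤ.- y
        telescope = solve-∀

  module _ {i j : Fin N} {ks : List (Fin N)}
           (ks<j : All (_< j) ks) (i<j : i < j)
           (sum≗ : columnSum A ks j ≗ (X (suc j) ⊖ X (suc i))) where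

    source-row-negative : columnSum A ks j i ≡ -1ℤ
    source-row-negative = trans (sum≗ i)
      (cong₂ ℤ._-_ (X-≢ (suc j) (Fin.<⇒≢ i<j ∘ Fin.suc-injective)) (X-≡ i))

    intermediate-row-nonpositive : ∀ {r} → r ∈ ks → columnSum A ks j r ℤ.≤ 0ℤ
    intermediate-row-nonpositive {r} r∈ks =
      subst (ℤ._≤ 0ℤ) (sym (trans (sum≗ r) (cong (ℤ._- X (suc i) r) (X-≢ (suc j) r≢j))))
        (ℤ.≤-trans (ℤ.≤-reflexive (ℤ.+-identityˡ _)) (ℤ.neg-mono-≤ (X-nonneg (suc i) r)))
      where
      r≢j : suc r ≢ suc j
      r≢j = Fin.<⇒≢ (All.lookup ks<j r∈ks) ∘ Fin.suc-injective

    successor : ∀ {r} → r ≡ i ⊎ r ∈ ks →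
      Any (λ k → ForwardAdjacent G (suc r) (suc k)) (ks ∷ʳ j)
    successor {r} r∈ with any? (λ k → forwardAdjacent? G (suc r) (suc k)) (ks ∷ʳ j)
    ... | yes e = e
    ... | no ¬e = case r∈ of λ where
        (inj₁ refl) → contradiction
          (subst (0ℤ ℤ.≤_) source-row-negative (columnSum-nonneg A ks entries≥0)) λ ()
        (inj₂ r∈ks) → contradiction
          (columnSum-pos A ks r∈ks 0<A entries≥0)
          (ℤ.≤⇒≯ (intermediate-row-nonpositive r∈ks))
      where
      entries≥0 = All.map A-nonneg (All.¬Any⇒All¬ _ ¬e)
      0<A : 0ℤ ℤ.< A r r
      0<A = subst (0ℤ ℤ.<_) (sym (A-diagonal r)) (ℤ.+<+ (s≤s z≤n))

    climb : ∀ {r} → Acc _>_ r → r ≡ i ⊎ r ∈ ks → ForwardConnected G (suc r) (suc j)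
    climb (acc rec) r∈ with find (successor r∈)
    ... | k , k∈ , e@(_ , s≤s r<k) with ∈-++⁻ ks k∈
    ...   | inj₁ k∈ks        = e ∷ climb (rec r<k) (inj₂ k∈ks)
    ...   | inj₂ (here refl) = [ e ]

    columnSum⇒forwardConnected : ForwardConnected G (suc i) (suc j)
    columnSum⇒forwardConnected = climb (>-wellFounded i) (inj₁ refl)

theorem4 : ∀ (N : ℕ) → 1 ≤ N → (G : SimpleGraph (ℕ.suc N)) →
    IsTree G → Terminal G zero → IncreasinglyIndexed G →
    (i : Fin (ℕ.suc N)) (j : Fin N) →
    ForwardConnected G i (suc j) ⇔
    (i < suc j ×
    (∃[ ks ] (Linked _<_ (i ∷ (map suc ks ∷ʳ suc j)) ×
    columnSum (forwardAdjacencyMatrix G) ks j ≗ (X (suc j) ⊖ X i))))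
theorem4 N _ G (connected , acyclic) _ increasing i j = mk⇔ to (from i)
  where
  to : ForwardConnected G i (suc j) → _
  to connection with forwardConnected⇒columnSum G connected increasing acyclic connection
  ... | ks , linked , sum≗ = All.head (linked-last (i ∷ map suc ks) linked) , ks , linked , sum≗

  from : ∀ i → (i < suc j × ∃[ ks ] (Linked _<_ (i ∷ (map suc ks ∷ʳ suc j)) ×
      columnSum (forwardAdjacencyMatrix G) ks j ≗ (X (suc j) ⊖ X i))) →
    ForwardConnected G i (suc j)
  from zero    _ = zero-forwardConnected G connected increasing j
  from (suc i) (s≤s i<j , ks , linked , sum≗) =
    columnSum⇒forwardConnected G ks<j i<j sum≗
    where
    ks<j = All.map ℕ.s<s⁻¹ (All.map⁻ (All.tail (linked-last (suc i ∷ map suc ks) linked)))
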